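{- Let $(W,S)$ be a finite Coxeter system, $Q=q_1\cdots q_m$ a non-empty word on $S$, $\rho\in W$, and let $Q_\vdash=q_2\cdots q_m$. Then the positive source tree $\mathcal P(Q,\rho)$ equals (i) $\mathcal P(Q_\vdash,q_1\rho)^{\rightarrow}$ if $1$ appears in none of the facets of $\mathcal{SC}(Q,\rho)$; (ii) $1\star\mathcal P(Q_\vdash,\rho)^{\rightarrow}$ if $1$ appears in all the facets of $\mathcal{SC}(Q,\rho)$; (iii) the disjoint union of $\mathcal P(Q_\vdash,q_1\rho)^{\rightarrow}$ and $1\star\mathcal P(Q_\vdash,\rho)^{\rightarrow}$, with an additional edge from $\mathsf P(Q,\rho)=\{1\}\cup\mathsf P(Q_\vdash,\rho)^{\rightarrow}$ to $\mathsf P(Q_\vdash,q_1\rho)^{\rightarrow}$, otherwise.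
   Context: Let $(W,S)$ be a finite Coxeter system with length function $\ell$. For a word $Q=q_1q_2\cdots q_m$ in the letters $S$ and $\rho\in W$, write $[m]=\{1,\dots,m\}$. The subword complex $\mathcal{SC}(Q,\rho)$ is the simplicial complex whose facets are the sets $I\subseteq[m]$ such that the letters of $Q$ at the positions in $[m]\setminus I$, read in increasing order of position, form a reduced expression of $\rho$. Positions in any word (in particular in $Q_\vdash$) are numbered from $1$. Two distinct facets $I,J$ are adjacent if $I\setminus\{i\}=J\setminus\{j\}$ for some $i\in I$, $j\in J$; the flip from $I$ to $J$ is increasing if $i<j$. The increasing flip graph $\mathcal G(Q,\rho)$ is the directed graph whose vertices are the facets and whose edges $I\to J$ are the increasing flips. For an edge $I\to J$ with $I\setminus\{i\}=J\setminus\{j\}$, $i<j$, set $\mathsf p(I\to J)=i$. A path is $\mathsf p$-rising if the sequence of $\mathsf p$-labels of its successive edges is strictly increasing. When $\mathcal{SC}(Q,\rho)$ is non-empty, the positive greedy facet $\mathsf P(Q,\rho)$ is the unique source of $\mathcal G(Q,\rho)$ (equivalently the lexicographically smallest facet), and the positive source tree $\mathcal P(Q,\rho)$ is the spanning tree of $\mathcal G(Q,\rho)$, directed away from $\mathsf P(Q,\rho)$, formed by all $\mathsf p$-rising paths from $\mathsf P(Q,\rho)$ to the facets of $\mathcal{SC}(Q,\rho)$ (there is exactly one such path to each facet). When $\mathcal{SC}(Q,\rho)$ has no facets, $\mathcal P(Q,\rho)$ is the empty tree. For $X\subseteq\mathbb Z$, $X^{\rightarrow}=\{x+1: x\in X\}$.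 For a directed tree $\mathcal T$ whose vertices are subsets of $\mathbb Z$, $\mathcal T^{\rightarrow}$ is the tree with vertices $X^{\rightarrow}$ for $X$ a vertex of $\mathcal T$ and edges $X^{\rightarrow}\to Y^{\rightarrow}$ for each edge $X\to Y$ of $\mathcal T$; and for $z\in\mathbb Z$, $z\star\mathcal T$ is the tree with vertices $X\cup\{z\}$ and edges $X\cup\{z\}\to Y\cup\{z\}$ for each vertex $X$ and edge $X\to Y$ of $\mathcal T$. -}

module Defs where

open import Algebra.Bundles using (Group)
open import Data.Fin.Base using (Fin; _<_)
open import Data.Fin.Subset using (Subset; inside; outside; _∈_; _∪_; _-_; ⁅_⁆)
open import Data.List.Base using (List; []; _∷_; _++_; length; foldr; concat; replicate)
import Data.List.Membership.Propositional as List
open import Data.List.Relation.Unary.Linked using (Linked)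
open import Data.Nat.Base using (ℕ; _≤_)
open import Data.Product.Base using (Σ; ∃-syntax; _×_; _,_)
open import Data.Sum.Base using (_⊎_)
open import Data.Vec.Base using (Vec; []; _∷_)
open import Function.Bundles using (_⇔_; Inverse)
open import Level using (Level; _⊔_) renaming (suc to lsuc)
open import Relation.Binary.Construct.Closure.Equivalence using (EqClosure)
open import Relation.Binary.Construct.Closure.ReflexiveTransitive using (Star; ε; _◅_)
open import Relation.Binary.PropositionalEquality using (_≡_; _≢_; setoid)
open import Relation.Nullary using (¬_)

-- The entry 0 stands for ∞: the relator (st)⁰ is the empty word, so it
-- imposes nothing.
record CoxeterMatrix (n : ℕ) : Set where
  field
    order       : Fin n → Fin n → ℕ
    symmetric   : ∀ s t → order s t ≡ order t s
    diagonal    : ∀ s → order s s ≡ 1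
    offDiagonal : ∀ s t → s ≢ t → order s t ≢ 1

  relator : Fin n → Fin n → List (Fin n)
  relator s t = concat (replicate (order s t) (s ∷ t ∷ []))

  data Deletes : List (Fin n) → List (Fin n) → Set where
    delete : ∀ u s t v → Deletes (u ++ relator s t ++ v) (u ++ v)

  -- Equality in the group ⟨ S ∣ (st)^m(s,t) = 1 ⟩.  Since ss is a relator,
  -- every generator is its own inverse, and words without formal inverses
  -- represent all elements.
  _∼_ : List (Fin n) → List (Fin n) → Set
  _∼_ = EqClosure Deletes

-- S is given by its finite index set Fin rank.  The last two fields say that
-- the map from the presented group to the given one is onto, well defined and
-- injective.
record CoxeterSystem (c ℓ : Level) : Set (lsuc (c ⊔ ℓ)) where
  field
    group  : Group c ℓ
    rank   : ℕ
    matrix : CoxeterMatrix rank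

  open Group group using (Carrier; _≈_; _∙_) renaming (ε to 𝟙)
  open CoxeterMatrix matrix using (_∼_)

  S : Set
  S = Fin rank

  field
    simple : S → Carrier

  ⟦_⟧ : List S → Carrier
  ⟦_⟧ = foldr (λ s w → simple s ∙ w) 𝟙

  field
    generates    : ∀ w → ∃[ u ] ⟦ u ⟧ ≈ w
    presentation : ∀ u v → (⟦ u ⟧ ≈ ⟦ v ⟧) ⇔ (u ∼ v)

  W : Set c
  W = Carrier

  infixr 7 _·_

  _·_ : S → W → W
  s · w = simple s ∙ w

  -- length u equals ℓ(w), the least length of a word representing w.
  IsReducedExpression : List S → W → Set ℓ
  IsReducedExpression u w = ⟦ u ⟧ ≈ w × (∀ v → ⟦ v ⟧ ≈ w → length u ≤ length v)

IsFinite : ∀ {c ℓ} → CoxeterSystem c ℓ → Set (c ⊔ ℓ)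
IsFinite C = ∃[ k ] Inverse (Group.setoid (CoxeterSystem.group C)) (setoid (Fin k))

record Digraph (A : Set) (ℓ : Level) : Set (lsuc ℓ) where
  field
    Vertex : A → Set ℓ
    Edge   : A → A → Set ℓ

open Digraph public

module _ {A : Set} {ℓ : Level} where

  infix  4 _≐_
  infixr 6 _⊍_

  -- Equality of vertex sets and of edge sets, not isomorphism.
  _≐_ : Digraph A ℓ → Digraph A ℓ → Set ℓ
  G ≐ H = (∀ x → Vertex G x ⇔ Vertex H x) × (∀ x y → Edge G x y ⇔ Edge H x y)

  Disjoint : Digraph A ℓ → Digraph A ℓ → Set ℓ
  Disjoint G H = ∀ x → ¬ (Vertex G x × Vertex H x)

  _⊍_ : Digraph A ℓ → Digraph A ℓ → Digraph A ℓ
  G ⊍ H = record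
    { Vertex = λ x → Vertex G x ⊎ Vertex H x
    ; Edge   = λ x y → Edge G x y ⊎ Edge H x y
    }

  addEdge : A → A → Digraph A ℓ → Digraph A ℓ
  addEdge a b G = record
    { Vertex = Vertex G
    ; Edge   = λ x y → Edge G x y ⊎ (x ≡ a × y ≡ b)
    }

mapDigraph : ∀ {A B : Set} {ℓ} → (A → B) → Digraph A ℓ → Digraph B ℓ
mapDigraph f G = record
  { Vertex = λ y → ∃[ x ] (Vertex G x × f x ≡ y)
  ; Edge   = λ y y′ → ∃[ x ] ∃[ x′ ] (Edge G x x′ × f x ≡ y × f x′ ≡ y′)
  }

-- The position p ∈ {1,…,m} is the element of Fin m with toℕ equal to p ∸ 1, so
-- that 1 is zero.  In X ^→ the elements are exactly suc x for x ∈ X.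
infixl 8 _^→ _^⇒
infixr 7 _⋆_

_^→ : ∀ {m} → Subset m → Subset (ℕ.suc m)
X ^→ = outside ∷ X

_^⇒ : ∀ {m ℓ} → Digraph (Subset m) ℓ → Digraph (Subset (ℕ.suc m)) ℓ
_^⇒ = mapDigraph _^→

_⋆_ : ∀ {m ℓ} → Fin m → Digraph (Subset m) ℓ → Digraph (Subset m) ℓ
z ⋆ T = mapDigraph (_∪ ⁅ z ⁆) T

lettersOutside : ∀ {A : Set} {m} → Vec A m → Subset m → List A
lettersOutside []      []            = []
lettersOutside (q ∷ Q) (inside  ∷ I) = lettersOutside Q I
lettersOutside (q ∷ Q) (outside ∷ I) = q ∷ lettersOutside Q I

module SubwordComplex {c ℓ} (C : CoxeterSystem c ℓ) where

  open CoxeterSystem C public using (S; W; _·_)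
  open CoxeterSystem C using (IsReducedExpression)

  module _ {m : ℕ} (Q : Vec S m) (ρ : W) where

    IsFacet : Subset m → Set ℓ
    IsFacet I = IsReducedExpression (lettersOutside Q I) ρ

    record IncreasingFlip (I J : Subset m) : Set ℓ where
      field
        facetˡ   : IsFacet I
        facetʳ   : IsFacet J
        distinct : I ≢ J
        i j      : Fin m
        i∈I      : i ∈ I
        j∈J      : j ∈ J
        ridge    : I - i ≡ J - j
        i<j      : i < j

    increasingFlipGraph : Digraph (Subset m) ℓ
    increasingFlipGraph = record { Vertex = IsFacet ; Edge = IncreasingFlip }

    Path : Subset m → Subset m → Set ℓ
    Path = Star (Edge increasingFlipGraph)

    𝗉 : ∀ {I J} → IncreasingFlip I J → Fin m
    𝗉 = IncreasingFlip.i

    labels : ∀ {I J} → Path I J → List (Fin m)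
    labels ε       = []
    labels (e ◅ π) = 𝗉 e ∷ labels π

    IsRising : ∀ {I J} → Path I J → Set
    IsRising π = Linked _<_ (labels π)

    edges : ∀ {I J} → Path I J → List (Subset m × Subset m)
    edges ε                 = []
    edges (_◅_ {I} {J} e π) = (I , J) ∷ edges π

    IsSource : Subset m → Set ℓ
    IsSource I = Vertex increasingFlipGraph I
               × (∀ J → ¬ Edge increasingFlipGraph J I)

    IsPositiveGreedyFacet : Subset m → Set ℓ
    IsPositiveGreedyFacet P = IsSource P × (∀ I → IsSource I → I ≡ P)

    -- Spanning, hence all facets are vertices; the edges are those traversed
    -- by some rising path starting at the positive greedy facet.
    positiveSourceTree : Digraph (Subset m) ℓ
    positiveSourceTree = record
      { Vertex = IsFacet
      ; Edge   = λ I J →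
          ∃[ P ] ∃[ K ] (IsPositiveGreedyFacet P × IsFacet K ×
            Σ (Path P K) λ π → IsRising π × ((I , J) List.∈ edges π))
      }

module Submission where

-- For w ∈ W let N(w) be the set of reflections t with ℓ(tw) < ℓ(w).  The
-- braid relators preserve the parity of the number of times a given reflection
-- occurs among the prefix reflections of a word, so membership in N(w) is
-- computed by any word for w, with a cocycle rule for products; the exchange
-- condition follows.
--
-- Reading Q from right to left and using each letter that is a right descent
-- of the element still to be spelled gives the positive greedy facet.  If s is
-- a left descent of ρ, the runs for ρ and sρ stay parallel (their states
-- differ by s on the left) until one letter merges them.  Hence
-- P(Q⊢, ρ) and P(Q⊢, q₁ρ) differ in one position, which is the additional edge
-- of the third case, and this edge is the only flip out of the root with label 1.
-- The merging also shows, by induction on Q, that the greedy facet is the only source.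
-- A rising path from the root that does not start with this edge keeps 1 in
-- every facet; after this edge 1 never comes back.

open import Defs
open import Algebra.Bundles using (Group)
import Algebra.Definitions.RawMonoid
import Algebra.Properties.Group
import Algebra.Properties.Monoid.Mult
open import Data.Bool.Base using (Bool; true; false; not; _xor_; if_then_else_)
open import Data.Bool.Properties using (xor-assoc; xor-identityʳ; xor-same)
open import Data.Fin.Base using (Fin; zero; suc; _<_)
import Data.Fin.Properties as Fin
open import Data.Fin.Subset using (Subset; Side; inside; outside; _∈_; _∉_; _∪_; _-_; ⁅_⁆)
open import Data.Fin.Subset.Properties using (p─⊥≡p; ∪-identityˡ; ∪-identityʳ)
open import Data.List.Base using (List; []; _∷_; _++_; length; concat; map; replicate)
import Data.List.Membership.Propositional as List
open import Data.List.Membership.Propositional.Properties using (∈-map⁺; ∈-map⁻)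
open import Data.List.Relation.Unary.All using (All; []; _∷_)
open import Data.List.Relation.Unary.Any using (here; there)
open import Data.List.Relation.Unary.Linked as Linked using (Linked; []; [-]; _∷_)
import Data.List.Relation.Unary.Linked.Properties as Linked
open import Data.Nat.Base as ℕ using (ℕ; z≤n; s≤s; _*_; _+_)
import Data.Nat.Properties as ℕ
open import Data.Product.Base using (∃-syntax; _×_; _,_; proj₁; proj₂)
open import Data.Sum.Base using (inj₁; inj₂)
open import Data.Sum.Function.Propositional using (_⊎-⇔_)
open import Data.Vec.Base using (Vec; []; _∷_; here; there)
open import Data.Vec.Properties using (∷-injectiveˡ; ∷-injectiveʳ)
open import Function.Base using (_∘_)
open import Function.Bundles using (_⇔_; mk⇔; Equivalence)
import Function.Properties.Equivalence as ⇔
open import Function.Properties.Inverse using (Inverse⇒Injection)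
open import Relation.Binary.Bundles using (Setoid)
open import Relation.Binary.Construct.Closure.Equivalence as EqClosure using ()
open import Relation.Binary.Construct.Closure.ReflexiveTransitive using (ε; _◅_)
import Relation.Binary.Construct.Closure.Symmetric as Sym
open import Relation.Binary.Definitions using (Decidable)
open import Relation.Binary.PropositionalEquality as ≡ using (_≡_; cong; cong₂; module ≡-Reasoning)
import Relation.Binary.Reasoning.Setoid as SetoidReasoning
open import Relation.Nullary using (¬_; yes; no; does; contradiction)
open import Relation.Nullary.Decidable using (does-⇔; dec-true; dec-false)

-- Parities of Boolean sequences.

parity : (ℕ → Bool) → ℕ → Bool
parity f ℕ.zero    = false
parity f (ℕ.suc n) = f 0 xor parity (f ∘ ℕ.suc) n

parity-cong : ∀ {f g} → (∀ j → f j ≡ g j) → ∀ n → parity f n ≡ parity g n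
parity-cong f≗g ℕ.zero    = ≡.refl
parity-cong f≗g (ℕ.suc n) = cong₂ _xor_ (f≗g 0) (parity-cong (f≗g ∘ ℕ.suc) n)

parity-+ : ∀ f m n → parity f (m + n) ≡ parity f m xor parity (f ∘ (m +_)) n
parity-+ f ℕ.zero    n = ≡.refl
parity-+ f (ℕ.suc m) n = ≡.trans (cong (f 0 xor_) (parity-+ (f ∘ ℕ.suc) m n))
                                 (≡.sym (xor-assoc (f 0) _ _))

-- The two halves of the range contribute the same parity and cancel.
parity-periodic : ∀ f m → (∀ j → f (m + j) ≡ f j) → parity f (m + m) ≡ false
parity-periodic f m periodic = begin
  parity f (m + m)                          ≡⟨ parity-+ f m m ⟩
  parity f m xor parity (f ∘ (m +_)) m      ≡⟨ cong (parity f m xor_) (parity-cong periodic m) ⟩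
  parity f m xor parity f m                 ≡⟨ xor-same (parity f m) ⟩
  false                                     ∎
  where open ≡-Reasoning

-- Conjugation in a group, written as a right action.

module Conjugation {c ℓ} (G : Group c ℓ) where

  open Group G renaming (ε to 𝟙)
  open Algebra.Properties.Group G using (⁻¹-anti-homo-∙; ε⁻¹≈ε; \\-leftDividesˡ)
  open SetoidReasoning setoid

  infixl 8 _^_

  _^_ : Carrier → Carrier → Carrier
  t ^ w = w ⁻¹ ∙ (t ∙ w)

  ^-cong : ∀ {t t′ w w′} → t ≈ t′ → w ≈ w′ → t ^ w ≈ t′ ^ w′
  ^-cong t≈t′ w≈w′ = ∙-cong (⁻¹-cong w≈w′) (∙-cong t≈t′ w≈w′)

  ^-𝟙 : ∀ t → t ^ 𝟙 ≈ t
  ^-𝟙 t = begin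
    𝟙 ⁻¹ ∙ (t ∙ 𝟙) ≈⟨ ∙-cong ε⁻¹≈ε (identityʳ t) ⟩
    𝟙 ∙ t          ≈⟨ identityˡ t ⟩
    t              ∎

  ^-∙ : ∀ t w v → t ^ (w ∙ v) ≈ t ^ w ^ v
  ^-∙ t w v = begin
    (w ∙ v) ⁻¹ ∙ (t ∙ (w ∙ v))        ≈⟨ ∙-cong (⁻¹-anti-homo-∙ w v) (sym (assoc t w v)) ⟩
    (v ⁻¹ ∙ w ⁻¹) ∙ ((t ∙ w) ∙ v)     ≈⟨ assoc _ _ _ ⟩
    v ⁻¹ ∙ (w ⁻¹ ∙ ((t ∙ w) ∙ v))     ≈⟨ ∙-congˡ (assoc _ _ _) ⟨
    v ⁻¹ ∙ ((w ⁻¹ ∙ (t ∙ w)) ∙ v)     ∎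

  ∙-^ : ∀ t w → w ∙ t ^ w ≈ t ∙ w
  ∙-^ t w = \\-leftDividesˡ w (t ∙ w)

  ^-inverseˡ : ∀ t w → t ^ (w ⁻¹) ^ w ≈ t
  ^-inverseˡ t w = begin
    t ^ (w ⁻¹) ^ w ≈⟨ ^-∙ t (w ⁻¹) w ⟨
    t ^ (w ⁻¹ ∙ w) ≈⟨ ^-cong refl (inverseˡ w) ⟩
    t ^ 𝟙          ≈⟨ ^-𝟙 t ⟩
    t              ∎

  ^-inverseʳ : ∀ t w → t ^ w ^ (w ⁻¹) ≈ t
  ^-inverseʳ t w = begin
    t ^ w ^ (w ⁻¹) ≈⟨ ^-∙ t w (w ⁻¹) ⟨
    t ^ (w ∙ w ⁻¹) ≈⟨ ^-cong refl (inverseʳ w) ⟩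
    t ^ 𝟙          ≈⟨ ^-𝟙 t ⟩
    t              ∎

  ^-self : ∀ t → t ^ t ≈ t
  ^-self t = begin
    t ⁻¹ ∙ (t ∙ t) ≈⟨ assoc _ _ _ ⟨
    t ⁻¹ ∙ t ∙ t   ≈⟨ ∙-congʳ (inverseˡ t) ⟩
    𝟙 ∙ t          ≈⟨ identityˡ t ⟩
    t              ∎

  ^-shift : ∀ {t t′ w} → (t ^ w ≈ t′) ⇔ (t ≈ t′ ^ (w ⁻¹))
  ^-shift {t} {t′} {w} = mk⇔
    (λ p → trans (sym (^-inverseʳ t w)) (^-cong p refl))
    (λ p → trans (^-cong p refl) (^-inverseˡ t′ w))

-- Inversions of words and the exchange condition.

module Inversions {c ℓ} (C : CoxeterSystem c ℓ)
                  (_≟_ : Decidable (Group._≈_ (CoxeterSystem.group C))) where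

  open CoxeterSystem C
  open CoxeterMatrix matrix
  open Group group renaming (ε to 𝟙)
  open Algebra.Definitions.RawMonoid rawMonoid renaming (_×_ to _⨉_)
  open Algebra.Properties.Monoid.Mult monoid using (×-homo-+; ×-homo-1)
  open Algebra.Properties.Group group using (inverseˡ-unique; ⁻¹-anti-homo-∙)
  open Conjugation group public
  module ≈-Reasoning = SetoidReasoning setoid

  δ : W → W → Bool
  δ x y = does (x ≟ y)

  δ-⇔ : ∀ {x y x′ y′} → (x ≈ y) ⇔ (x′ ≈ y′) → δ x y ≡ δ x′ y′
  δ-⇔ eq = does-⇔ eq (_ ≟ _) (_ ≟ _)

  δ-cong : ∀ {x y x′ y′} → x ≈ x′ → y ≈ y′ → δ x y ≡ δ x′ y′
  δ-cong p q = δ-⇔ (mk⇔ (λ r → trans (sym p) (trans r q)) (λ r → trans p (trans r (sym q))))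

  -- Conjugation is injective, so an equality test survives conjugating both sides by `w`.
  δ-^ : ∀ w {x y x′ y′} → x ^ w ≈ x′ → y ^ w ≈ y′ → δ x y ≡ δ x′ y′
  δ-^ w {x} {y} {x′} {y′} p q = δ-⇔ (mk⇔
    (λ r → trans (sym p) (trans (^-cong r refl) q))
    (λ r → trans (sym (^-inverseʳ x w)) (trans (^-cong (trans p (trans r (sym q))) refl) (^-inverseʳ y w))))

  ⟦⟧-++ : ∀ u v → ⟦ u ++ v ⟧ ≈ ⟦ u ⟧ ∙ ⟦ v ⟧
  ⟦⟧-++ []      v = sym (identityˡ _)
  ⟦⟧-++ (s ∷ u) v = trans (∙-congˡ (⟦⟧-++ u v)) (sym (assoc _ _ _))

  ⟦relator⟧ : ∀ s t → ⟦ relator s t ⟧ ≈ 𝟙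
  ⟦relator⟧ s t = begin
    ⟦ relator s t ⟧       ≈⟨ trans (⟦⟧-++ (relator s t) []) (identityʳ _) ⟨
    ⟦ relator s t ++ [] ⟧ ≈⟨ Equivalence.from (presentation _ _) (Sym.fwd (delete [] s t []) ◅ ε) ⟩
    𝟙                     ∎
    where open ≈-Reasoning

  simple-involutive : ∀ s → simple s ∙ simple s ≈ 𝟙
  simple-involutive s = begin
    simple s ∙ simple s         ≈⟨ ∙-congˡ (identityʳ _) ⟨
    ⟦ s ∷ s ∷ [] ⟧              ≡⟨ cong (λ k → ⟦ concat (replicate k (s ∷ s ∷ [])) ⟧) (diagonal s) ⟨
    ⟦ relator s s ⟧             ≈⟨ ⟦relator⟧ s s ⟩
    𝟙                           ∎
    where open ≈-Reasoning

  simple⁻¹ : ∀ s → simple s ⁻¹ ≈ simple s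
  simple⁻¹ s = sym (inverseˡ-unique _ _ (simple-involutive s))

  simple-cancelˡ : ∀ s w → s · s · w ≈ w
  simple-cancelˡ s w = begin
    simple s ∙ (simple s ∙ w) ≈⟨ assoc _ _ _ ⟨
    simple s ∙ simple s ∙ w   ≈⟨ ∙-congʳ (simple-involutive s) ⟩
    𝟙 ∙ w                     ≈⟨ identityˡ w ⟩
    w                         ∎
    where open ≈-Reasoning

  -- For t a reflection, inv u t is the parity of the number of positions of u
  -- whose deletion multiplies ⟦ u ⟧ by t on the left.
  inv : List S → W → Bool
  inv []      t = false
  inv (s ∷ u) t = δ t (simple s) xor inv u (t ^ simple s)

  inv-cong : ∀ u {t t′} → t ≈ t′ → inv u t ≡ inv u t′
  inv-cong []      p = ≡.refl
  inv-cong (s ∷ u) p = cong₂ _xor_ (δ-cong p refl) (inv-cong u (^-cong p refl))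

  -- The prefix reflections of `u ++ v` are those of `u` followed by those of `v` conjugated by
  -- `⟦ u ⟧`; here the inverse conjugation is applied to `t` instead.
  inv-++ : ∀ u v t → inv (u ++ v) t ≡ inv u t xor inv v (t ^ ⟦ u ⟧)
  inv-++ []      v t = inv-cong v (sym (^-𝟙 t))
  inv-++ (s ∷ u) v t = begin
    δ t (simple s) xor inv (u ++ v) (t ^ simple s)
      ≡⟨ cong (δ t (simple s) xor_) (inv-++ u v (t ^ simple s)) ⟩
    δ t (simple s) xor (inv u (t ^ simple s) xor inv v (t ^ simple s ^ ⟦ u ⟧))
      ≡⟨ cong (λ b → δ t (simple s) xor (inv u (t ^ simple s) xor b)) (inv-cong v (^-∙ t _ _)) ⟨
    δ t (simple s) xor (inv u (t ^ simple s) xor inv v (t ^ ⟦ s ∷ u ⟧))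
      ≡⟨ xor-assoc (δ t (simple s)) _ _ ⟨
    inv (s ∷ u) t xor inv v (t ^ ⟦ s ∷ u ⟧) ∎
    where open ≡-Reasoning

  module _ (s t : S) where

    private
      p : W
      p = simple s ∙ simple t

    -- The reflections met along (st)^k are pʲ s for j < 2k.
    reflection : ℕ → W
    reflection j = j ⨉ p ∙ simple s

    ⟦power⟧ : ∀ k → ⟦ concat (replicate k (s ∷ t ∷ [])) ⟧ ≈ k ⨉ p
    ⟦power⟧ ℕ.zero    = refl
    ⟦power⟧ (ℕ.suc k) = trans (sym (assoc _ _ _)) (∙-congˡ (⟦power⟧ k))

    reflection-zero : reflection 0 ≈ simple s
    reflection-zero = identityˡ _

    reflection-one : reflection 1 ^ simple s ≈ simple t
    reflection-one = begin
      simple s ⁻¹ ∙ (p ∙ 𝟙 ∙ simple s ∙ simple s)   ≈⟨ ∙-cong (simple⁻¹ s) (assoc _ _ _) ⟩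
      simple s ∙ (p ∙ 𝟙 ∙ (simple s ∙ simple s))    ≈⟨ ∙-congˡ (∙-cong (identityʳ p) (simple-involutive s)) ⟩
      simple s ∙ (p ∙ 𝟙)                            ≈⟨ ∙-congˡ (identityʳ p) ⟩
      simple s ∙ (simple s ∙ simple t)              ≈⟨ simple-cancelˡ s _ ⟩
      simple t                                      ∎
      where open ≈-Reasoning

    -- This is the dihedral relation: conjugation by `simple s` inverts `p`.
    p∙s∙p : p ∙ (simple s ∙ p) ≈ simple s
    p∙s∙p = begin
      p ∙ (simple s ∙ (simple s ∙ simple t)) ≈⟨ ∙-congˡ (simple-cancelˡ s _) ⟩
      simple s ∙ simple t ∙ simple t         ≈⟨ assoc _ _ _ ⟩
      simple s ∙ (simple t ∙ simple t)       ≈⟨ ∙-congˡ (simple-involutive t) ⟩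
      simple s ∙ 𝟙                           ≈⟨ identityʳ _ ⟩
      simple s                               ∎
      where open ≈-Reasoning

    -- By the dihedral relation, passing a leading `st` shifts the sequence of reflections by two.
    reflection-2+ : ∀ j → reflection (2 + j) ^ p ≈ reflection j
    reflection-2+ j = begin
      p ⁻¹ ∙ ((p ∙ (1 + j) ⨉ p) ∙ simple s ∙ p) ≈⟨ ∙-congˡ (trans (assoc _ _ _) (assoc _ _ _)) ⟩
      p ⁻¹ ∙ (p ∙ ((1 + j) ⨉ p ∙ (simple s ∙ p))) ≈⟨ trans (sym (assoc _ _ _)) (trans (∙-congʳ (inverseˡ p)) (identityˡ _)) ⟩
      (1 + j) ⨉ p ∙ (simple s ∙ p)      ≡⟨ cong (λ k → k ⨉ p ∙ (simple s ∙ p)) (ℕ.+-comm 1 j) ⟩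
      (j + 1) ⨉ p ∙ (simple s ∙ p)      ≈⟨ ∙-congʳ (trans (×-homo-+ p j 1) (∙-congˡ (×-homo-1 p))) ⟩
      j ⨉ p ∙ p ∙ (simple s ∙ p)        ≈⟨ assoc _ _ _ ⟩
      j ⨉ p ∙ (p ∙ (simple s ∙ p))      ≈⟨ ∙-congˡ p∙s∙p ⟩
      j ⨉ p ∙ simple s                  ∎
      where open ≈-Reasoning

    inv-power : ∀ k x → inv (concat (replicate k (s ∷ t ∷ []))) x ≡ parity (δ x ∘ reflection) (k * 2)
    inv-power ℕ.zero    x = ≡.refl
    -- The first two letters contribute `reflection 0` and `reflection 1`; the remaining power is
    -- read after conjugation by `p`.
    inv-power (ℕ.suc k) x = cong₂ _xor_ (δ-cong refl (sym reflection-zero))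
      (cong₂ _xor_ (≡.sym (δ-^ (simple s) refl reflection-one)) (begin
        inv (concat (replicate k (s ∷ t ∷ []))) (x ^ simple s ^ simple t)
          ≡⟨ inv-cong (concat (replicate k (s ∷ t ∷ []))) (^-∙ x _ _) ⟨
        inv (concat (replicate k (s ∷ t ∷ []))) (x ^ p)
          ≡⟨ inv-power k (x ^ p) ⟩
        parity (δ (x ^ p) ∘ reflection) (k * 2)
          ≡⟨ parity-cong (λ j → ≡.sym (δ-^ p refl (reflection-2+ j))) (k * 2) ⟩
        parity (λ j → δ x (reflection (2 + j))) (k * 2) ∎))
      where open ≡-Reasoning

    -- Since `p` to the power `order s t` is `𝟙`, the reflections repeat with this period, and the
    -- relator runs through exactly two periods.
    inv-relator : ∀ x → inv (relator s t) x ≡ false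
    inv-relator x = begin
      inv (relator s t) x                       ≡⟨ inv-power m x ⟩
      parity (δ x ∘ reflection) (m * 2)         ≡⟨ cong (parity (δ x ∘ reflection)) m*2≡m+m ⟩
      parity (δ x ∘ reflection) (m + m)         ≡⟨ parity-periodic (δ x ∘ reflection) m (λ j → δ-cong refl (periodic j)) ⟩
      false                                     ∎
      where
      open ≡-Reasoning
      m = order s t
      m*2≡m+m : m * 2 ≡ m + m
      m*2≡m+m = ≡.trans (ℕ.*-comm m 2) (cong (m +_) (ℕ.+-identityʳ m))
      periodic : ∀ j → reflection (m + j) ≈ reflection j
      periodic j = ∙-congʳ (trans (×-homo-+ p m j)
        (trans (∙-congʳ (trans (sym (⟦power⟧ m)) (⟦relator⟧ s t))) (identityˡ _)))

  inv-deletes : ∀ {u v} → Deletes u v → ∀ x → inv u x ≡ inv v x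
  inv-deletes (delete u s t v) x = begin
    inv (u ++ relator s t ++ v) x
      ≡⟨ inv-++ u (relator s t ++ v) x ⟩
    inv u x xor inv (relator s t ++ v) y
      ≡⟨ cong (inv u x xor_) (inv-++ (relator s t) v y) ⟩
    inv u x xor (inv (relator s t) y xor inv v (y ^ ⟦ relator s t ⟧))
      ≡⟨ cong (λ b → inv u x xor (b xor inv v (y ^ ⟦ relator s t ⟧))) (inv-relator s t y) ⟩
    inv u x xor inv v (y ^ ⟦ relator s t ⟧)
      ≡⟨ cong (inv u x xor_) (inv-cong v (trans (^-cong refl (⟦relator⟧ s t)) (^-𝟙 y))) ⟩
    inv u x xor inv v y
      ≡⟨ inv-++ u v x ⟨
    inv (u ++ v) x ∎
    where
    open ≡-Reasoning
    y = x ^ ⟦ u ⟧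

  -- By the presentation, words for the same element are joined by deletions and insertions of
  -- relators, each of which preserves `inv`.
  inv-⟦⟧ : ∀ u v → ⟦ u ⟧ ≈ ⟦ v ⟧ → ∀ x → inv u x ≡ inv v x
  inv-⟦⟧ u v p = EqClosure.gfold (Setoid.isEquivalence (W ≡.→-setoid Bool)) inv inv-deletes
    (Equivalence.to (presentation u v) p)

  -- An odd number of occurrences is at least one; the letter at the first occurrence of `t` is
  -- deleted.
  exchange : ∀ u t → inv u t ≡ true → ∃[ v ] (⟦ v ⟧ ≈ t ∙ ⟦ u ⟧ × ℕ.suc (length v) ≡ length u)
  exchange (s ∷ u) t eq with t ≟ simple s
  ... | yes t≈s = u , sym (trans (∙-congʳ t≈s) (simple-cancelˡ s ⟦ u ⟧)) , ≡.refl
  ... | no _ with exchange u (t ^ simple s) eq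
  ...   | v , ⟦v⟧ , ∣v∣ = s ∷ v , lemma , cong ℕ.suc ∣v∣
    where
    open ≈-Reasoning
    lemma : ⟦ s ∷ v ⟧ ≈ t ∙ ⟦ s ∷ u ⟧
    lemma = begin
      simple s ∙ ⟦ v ⟧                     ≈⟨ ∙-congˡ ⟦v⟧ ⟩
      simple s ∙ (t ^ simple s ∙ ⟦ u ⟧)    ≈⟨ assoc _ _ _ ⟨
      simple s ∙ t ^ simple s ∙ ⟦ u ⟧      ≈⟨ ∙-congʳ (∙-^ t (simple s)) ⟩
      t ∙ simple s ∙ ⟦ u ⟧                 ≈⟨ assoc _ _ _ ⟩
      t ∙ (simple s ∙ ⟦ u ⟧)               ∎

  -- For t a reflection: t w is shorter than w.
  N : W → W → Bool
  N w = inv (proj₁ (generates w))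

  N-⟦⟧ : ∀ u {w} → ⟦ u ⟧ ≈ w → ∀ t → N w t ≡ inv u t
  N-⟦⟧ u p = inv-⟦⟧ (proj₁ (generates _)) u (trans (proj₂ (generates _)) (sym p))

  N-cong : ∀ {w w′ t t′} → w ≈ w′ → t ≈ t′ → N w t ≡ N w′ t′
  N-cong {w} {w′} {t} p q = ≡.trans (N-⟦⟧ (proj₁ (generates w′)) (trans (proj₂ (generates w′)) (sym p)) t) (inv-cong (proj₁ (generates w′)) q)

  N-𝟙 : ∀ {w} → w ≈ 𝟙 → ∀ t → N w t ≡ false
  N-𝟙 p = N-⟦⟧ [] (sym p)

  N-simple : ∀ s t → N (simple s) t ≡ δ t (simple s)
  N-simple s t = ≡.trans (N-⟦⟧ (s ∷ []) (identityʳ _) t) (xor-identityʳ _)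

  N-∙ : ∀ w v t → N (w ∙ v) t ≡ N w t xor N v (t ^ w)
  N-∙ w v t with generates w | generates v
  ... | a , ⟦a⟧ | b , ⟦b⟧ = begin
    N (w ∙ v) t                     ≡⟨ N-⟦⟧ (a ++ b) (trans (⟦⟧-++ a b) (∙-cong ⟦a⟧ ⟦b⟧)) t ⟩
    inv (a ++ b) t                  ≡⟨ inv-++ a b t ⟩
    inv a t xor inv b (t ^ ⟦ a ⟧)   ≡⟨ cong (inv a t xor_) (inv-cong b (^-cong refl ⟦a⟧)) ⟩
    inv a t xor inv b (t ^ w)       ∎
    where open ≡-Reasoning

  -- In the cocycle rule the first term is `true`, and `simple s` is fixed by conjugation with
  -- itself.
  N-· : ∀ s w → N (s · w) (simple s) ≡ not (N w (simple s))
  N-· s w = ≡.trans (N-∙ (simple s) w (simple s))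
    (cong₂ _xor_ (≡.trans (N-simple s (simple s)) (dec-true (_ ≟ _) refl)) (N-cong refl (^-self (simple s))))

  -- Reduced expressions and descents.

  IsReducedExpression-cong : ∀ {u w w′} → w ≈ w′ → IsReducedExpression u w → IsReducedExpression u w′
  IsReducedExpression-cong p (⟦u⟧ , min) = trans ⟦u⟧ p , λ v ⟦v⟧ → min v (trans ⟦v⟧ (sym p))

  reduced-[] : ∀ {w} → w ≈ 𝟙 → IsReducedExpression [] w
  reduced-[] p = sym p , λ _ _ → z≤n

  -- Exchange turns any word for `w` into a word for `s · w` that is one letter shorter, and
  -- minimality of `u` applies to the latter.
  reduced-∷ : ∀ {s u w} → IsReducedExpression u (s · w) → N w (simple s) ≡ true →
              IsReducedExpression (s ∷ u) w
  reduced-∷ {s} {u} {w} (⟦u⟧ , min) eq =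
    trans (∙-congˡ ⟦u⟧) (simple-cancelˡ s w) , λ v ⟦v⟧ → shorter v ⟦v⟧
      (exchange v (simple s) (≡.trans (≡.sym (N-⟦⟧ v ⟦v⟧ (simple s))) eq))
    where
    shorter : ∀ v → ⟦ v ⟧ ≈ w → ∃[ v′ ] (⟦ v′ ⟧ ≈ simple s ∙ ⟦ v ⟧ × ℕ.suc (length v′) ≡ length v) →
              ℕ.suc (length u) ℕ.≤ length v
    shorter v ⟦v⟧ (v′ , ⟦v′⟧ , ∣v′∣) = ≡.subst (ℕ.suc (length u) ℕ.≤_) ∣v′∣
      (s≤s (min v′ (trans ⟦v′⟧ (∙-congˡ ⟦v⟧))))

  reduced-tail : ∀ {s u w} → IsReducedExpression (s ∷ u) w → IsReducedExpression u (s · w)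
  reduced-tail {s} {u} {w} (⟦su⟧ , min) =
    trans (sym (simple-cancelˡ s ⟦ u ⟧)) (∙-congˡ ⟦su⟧) ,
    λ v ⟦v⟧ → ℕ.≤-pred (min (s ∷ v) (trans (∙-congˡ ⟦v⟧) (simple-cancelˡ s w)))

  -- Otherwise `s` would be a left descent of `s · w`, and exchange would shorten `u` to a word for
  -- `w` that is two letters shorter than `s ∷ u`.
  reduced-descent : ∀ {s u w} → IsReducedExpression (s ∷ u) w → N w (simple s) ≡ true
  reduced-descent {s} {u} {w} r@(⟦su⟧ , min) with N w (simple s) in eq
  ... | true  = ≡.refl
  ... | false with exchange u (simple s) (≡.trans (≡.sym (N-⟦⟧ u (proj₁ (reduced-tail {u = u} r)) (simple s)))
                                          (≡.trans (N-· s w) (cong not eq)))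
  ...   | v , ⟦v⟧ , ∣v∣ = contradiction (min v (trans ⟦v⟧ (trans (∙-congˡ (proj₁ (reduced-tail {u = u} r))) (simple-cancelˡ s w))))
          (ℕ.<⇒≱ (s≤s (≡.subst (length v ℕ.≤_) ∣v∣ (ℕ.n≤1+n _))))

  -- For t a reflection: w t is shorter than w.
  R : W → W → Bool
  R w t = N w (t ^ (w ⁻¹))

  R-cong : ∀ {w w′ t t′} → w ≈ w′ → t ≈ t′ → R w t ≡ R w′ t′
  R-cong p q = N-cong p (^-cong q (⁻¹-cong p))

  R-∙ : ∀ w v t → R (w ∙ v) t ≡ R w (t ^ (v ⁻¹)) xor R v t
  R-∙ w v t = ≡.trans (N-∙ w v _) (cong₂ _xor_ (N-cong refl p) (N-cong refl (trans (^-cong p refl) (^-inverseˡ _ w))))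
    where
    p : t ^ ((w ∙ v) ⁻¹) ≈ t ^ (v ⁻¹) ^ (w ⁻¹)
    p = trans (^-cong refl (⁻¹-anti-homo-∙ w v)) (^-∙ t _ _)

  R-simple : ∀ s t → R (simple s) t ≡ δ t (simple s)
  R-simple s t = ≡.trans (N-simple s _) (δ-^ (simple s) (^-inverseˡ t _) (^-self _))

  -- Left multiplication by `s` changes `R` only at the `t` with `s · w ≈ w ∙ t`; `compare` branches
  -- on this equation.
  R-· : ∀ s w t → R (s · w) t ≡ δ (t ^ (w ⁻¹)) (simple s) xor R w t
  R-· s w t = ≡.trans (R-∙ (simple s) w t) (cong (_xor R w t) (R-simple s _))

-- The greedy run and its facet.

module Greedy {c ℓ} (C : CoxeterSystem c ℓ)
              (_≟_ : Decidable (Group._≈_ (CoxeterSystem.group C))) where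

  open CoxeterSystem C
  open Group group hiding (_-_) renaming (ε to 𝟙)
  open Inversions C _≟_
  open SubwordComplex C using (IsFacet)

  -- Q is read from right to left: a letter is used exactly when it is a right
  -- descent of the element still to be spelled.
  residue : ∀ {m} → Vec S m → W → W
  residue []      ρ = ρ
  residue (q ∷ Q) ρ = if R (residue Q ρ) (simple q) then residue Q ρ ∙ simple q else residue Q ρ

  greedy : ∀ {m} → Vec S m → W → Subset m
  greedy []      ρ = []
  greedy (q ∷ Q) ρ = not (R (residue Q ρ) (simple q)) ∷ greedy Q ρ

  greedyWord : ∀ {m} → Vec S m → W → List S
  greedyWord Q ρ = lettersOutside Q (greedy Q ρ)

  residue-∙ : ∀ {m} (Q : Vec S m) ρ → residue Q ρ ∙ ⟦ greedyWord Q ρ ⟧ ≈ ρ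
  residue-∙ []      ρ = identityʳ ρ
  residue-∙ (q ∷ Q) ρ with R (residue Q ρ) (simple q)
  ... | false = residue-∙ Q ρ
  ... | true  = begin
    residue Q ρ ∙ simple q ∙ (simple q ∙ ⟦ greedyWord Q ρ ⟧)   ≈⟨ assoc _ _ _ ⟩
    residue Q ρ ∙ (simple q ∙ (simple q ∙ ⟦ greedyWord Q ρ ⟧)) ≈⟨ ∙-congˡ (simple-cancelˡ q _) ⟩
    residue Q ρ ∙ ⟦ greedyWord Q ρ ⟧                           ≈⟨ residue-∙ Q ρ ⟩
    ρ                                                          ∎
    where open ≈-Reasoning

  -- Lengths add up in ρ = residue Q ρ ∙ ⟦ greedyWord Q ρ ⟧.
  residue-disjoint : ∀ {m} (Q : Vec S m) ρ t → R (residue Q ρ) t ≡ true → N ⟦ greedyWord Q ρ ⟧ t ≡ false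
  residue-disjoint []      ρ t eq = N-𝟙 refl t
  residue-disjoint (q ∷ Q) ρ t eq with R (residue Q ρ) (simple q) in desc
  ... | false = residue-disjoint Q ρ t eq
  ... | true with t ≟ simple q
  ...   | yes t≈q = contradiction (≡.trans (≡.sym eq) (begin
    R (residue Q ρ ∙ simple q) t
      ≡⟨ R-∙ (residue Q ρ) (simple q) t ⟩
    R (residue Q ρ) (t ^ (simple q ⁻¹)) xor R (simple q) t
      ≡⟨ cong₂ _xor_ (≡.trans (R-cong refl t^q⁻¹≈q) desc)
                     (≡.trans (R-simple q t) (dec-true (t ≟ simple q) t≈q)) ⟩
    false ∎)) λ ()
    where
    open ≡-Reasoning
    t^q⁻¹≈q : t ^ (simple q ⁻¹) ≈ simple q
    t^q⁻¹≈q = trans (^-cong t≈q (simple⁻¹ q)) (^-self (simple q))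
  ...   | no t≉q = begin
    N (simple q ∙ ⟦ greedyWord Q ρ ⟧) t
      ≡⟨ N-∙ (simple q) _ t ⟩
    N (simple q) t xor N ⟦ greedyWord Q ρ ⟧ (t ^ simple q)
      ≡⟨ cong₂ _xor_ (≡.trans (N-simple q t) (dec-false (t ≟ simple q) t≉q))
                     (residue-disjoint Q ρ (t ^ simple q) eq′) ⟩
    false ∎
    where
    open ≡-Reasoning
    eq′ : R (residue Q ρ) (t ^ simple q) ≡ true
    eq′ = begin
      R (residue Q ρ) (t ^ simple q)
        ≡⟨ R-cong refl (^-cong refl (simple⁻¹ q)) ⟨
      R (residue Q ρ) (t ^ (simple q ⁻¹))
        ≡⟨ xor-identityʳ _ ⟨
      R (residue Q ρ) (t ^ (simple q ⁻¹)) xor false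
        ≡⟨ cong (R (residue Q ρ) (t ^ (simple q ⁻¹)) xor_) (≡.trans (R-simple q t) (dec-false (t ≟ simple q) t≉q)) ⟨
      R (residue Q ρ) (t ^ (simple q ⁻¹)) xor R (simple q) t
        ≡⟨ R-∙ (residue Q ρ) (simple q) t ⟨
      R (residue Q ρ ∙ simple q) t
        ≡⟨ eq ⟩
      true ∎

  -- A letter is used only if it is a right descent of the residue; by `residue-disjoint` it is then
  -- no left descent of the word spelled so far, so prepending it keeps the word reduced.
  greedyWord-reduced : ∀ {m} (Q : Vec S m) ρ → IsReducedExpression (greedyWord Q ρ) ⟦ greedyWord Q ρ ⟧
  greedyWord-reduced []      ρ = reduced-[] refl
  greedyWord-reduced (q ∷ Q) ρ with R (residue Q ρ) (simple q) in desc
  ... | false = greedyWord-reduced Q ρ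
  ... | true  = reduced-∷ {u = greedyWord Q ρ}
    (IsReducedExpression-cong {greedyWord Q ρ} (sym (simple-cancelˡ q _)) (greedyWord-reduced Q ρ))
    (≡.trans (N-· q _) (cong not (residue-disjoint Q ρ (simple q) desc)))

  greedy-facet : ∀ {m} (Q : Vec S m) ρ → residue Q ρ ≈ 𝟙 → IsFacet Q ρ (greedy Q ρ)
  greedy-facet Q ρ σ≈𝟙 = IsReducedExpression-cong {greedyWord Q ρ}
    (trans (sym (identityˡ _)) (trans (∙-congʳ (sym σ≈𝟙)) (residue-∙ Q ρ))) (greedyWord-reduced Q ρ)

  -- In `parallel`, the invariant that `s` is still a left descent of `σ` forces `σ` to differ from
  -- `𝟙`. Hence a run for `ρ` that ends at `𝟙` must have merged.
  data Comparison {m} (s : S) (σ σ′ : W) (I I′ : Subset m) : Set ℓ where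
    parallel : σ′ ≈ s · σ → I′ ≡ I → N σ (simple s) ≡ true → Comparison s σ σ′ I I′
    merged   : σ′ ≈ σ → ∀ j → j ∈ I′ → I′ - j ≡ I → Comparison s σ σ′ I I′

  -- The two runs differ by s on the left until s passes through the letter q
  -- with s σ = σ q; there only the run for ρ uses q, and the runs agree from then on.
  compare : ∀ {m} s (Q : Vec S m) ρ → N ρ (simple s) ≡ true →
            Comparison s (residue Q ρ) (residue Q (s · ρ)) (greedy Q ρ) (greedy Q (s · ρ))
  compare s []      ρ desc = parallel refl ≡.refl desc
  compare s (q ∷ Q) ρ desc with compare s Q ρ desc
  ... | merged σ′≈σ j j∈ ridge
      rewrite R-cong σ′≈σ (refl {x = simple q}) with R (residue Q ρ) (simple q)
  ...   | true  = merged (∙-congʳ σ′≈σ) (suc j) (there j∈) (cong (outside ∷_) ridge)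
  ...   | false = merged σ′≈σ (suc j) (there j∈) (cong (inside ∷_) ridge)
  compare s (q ∷ Q) ρ desc | parallel σ′≈sσ same descσ
      rewrite ≡.trans (R-cong σ′≈sσ (refl {x = simple q})) (R-· s (residue Q ρ) (simple q))
      with (simple q ^ (residue Q ρ ⁻¹)) ≟ simple s
  -- Here `q` is a right descent of `residue Q ρ` because `s` is a left descent of it; by `R-·` it
  -- is not a right descent of `residue Q (s · ρ)`.
  ... | yes q^σ⁻¹≈s
      rewrite ≡.trans (N-cong (refl {x = residue Q ρ}) q^σ⁻¹≈s) descσ
      = merged σ′≈σq zero here (cong (outside ∷_) (≡.trans (p─⊥≡p _) same))
    where
    open ≈-Reasoning
    σ′≈σq : residue Q (s · ρ) ≈ residue Q ρ ∙ simple q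
    σ′≈σq = begin
      residue Q (s · ρ)                                ≈⟨ σ′≈sσ ⟩
      simple s ∙ residue Q ρ                           ≈⟨ ∙-congʳ q^σ⁻¹≈s ⟨
      simple q ^ (residue Q ρ ⁻¹) ∙ residue Q ρ        ≈⟨ ∙-^ _ _ ⟨
      residue Q ρ ∙ simple q ^ (residue Q ρ ⁻¹) ^ residue Q ρ ≈⟨ ∙-congˡ (^-inverseˡ _ _) ⟩
      residue Q ρ ∙ simple q                           ∎
  ... | no q^σ⁻¹≉s with R (residue Q ρ) (simple q)
  ...   | false = parallel σ′≈sσ (cong (inside ∷_) same) descσ
  -- Removing `q` on the right can cost the left descent `s` only if `s` conjugates to `q`, which is
  -- excluded.
  ...   | true  = parallel (trans (∙-congʳ σ′≈sσ) (assoc _ _ _)) (cong (outside ∷_) same) (begin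
    N (residue Q ρ ∙ simple q) (simple s)
      ≡⟨ N-∙ (residue Q ρ) (simple q) (simple s) ⟩
    N (residue Q ρ) (simple s) xor N (simple q) (simple s ^ residue Q ρ)
      ≡⟨ cong₂ _xor_ descσ (≡.trans (N-simple q _) (dec-false (_ ≟ _) s^σ≉q)) ⟩
    true ∎)
    where
    open ≡-Reasoning
    s^σ≉q : ¬ (simple s ^ residue Q ρ ≈ simple q)
    s^σ≉q p = q^σ⁻¹≉s (sym (Equivalence.to ^-shift p))

  facet-outside : ∀ {m q} {Q : Vec S m} {ρ I} → N ρ (simple q) ≡ true →
                  IsFacet (q ∷ Q) ρ (outside ∷ I) ⇔ IsFacet Q (q · ρ) I
  facet-outside {Q = Q} {I = I} desc = mk⇔ (reduced-tail {u = lettersOutside Q I}) (λ f → reduced-∷ {u = lettersOutside Q I} f desc)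

  residue-𝟙-inside : ∀ {m} q (Q : Vec S m) ρ → residue Q ρ ≈ 𝟙 →
                     residue (q ∷ Q) ρ ≈ 𝟙 × greedy (q ∷ Q) ρ ≡ inside ∷ greedy Q ρ
  residue-𝟙-inside q Q ρ σ≈𝟙 rewrite N-𝟙 σ≈𝟙 (simple q ^ (residue Q ρ ⁻¹)) = σ≈𝟙 , ≡.refl

  residue-simple-outside : ∀ {m} q (Q : Vec S m) ρ → residue Q ρ ≈ simple q →
                           residue (q ∷ Q) ρ ≈ 𝟙 × greedy (q ∷ Q) ρ ≡ outside ∷ greedy Q ρ
  residue-simple-outside q Q ρ σ≈q
    rewrite ≡.trans (R-cong σ≈q (refl {x = simple q})) (≡.trans (R-simple q _) (dec-true (simple q ≟ simple q) refl))
    = trans (∙-congʳ σ≈q) (simple-involutive q) , ≡.refl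

  -- The greedy run succeeds as soon as any facet exists. If the facet uses `q`, the run for `q · ρ`
  -- ends at `𝟙`; the run for `ρ` is then either already at `𝟙` and skips `q`, or at `simple q` and
  -- uses it.
  facet⇒residue : ∀ {m} (Q : Vec S m) ρ {I} → IsFacet Q ρ I → residue Q ρ ≈ 𝟙
  facet⇒residue []      ρ {[]}          (𝟙≈ρ , _) = sym 𝟙≈ρ
  facet⇒residue (q ∷ Q) ρ {inside ∷ I}  f = proj₁ (residue-𝟙-inside q Q ρ (facet⇒residue Q ρ f))
  facet⇒residue (q ∷ Q) ρ {outside ∷ I} f
    with facet⇒residue Q (q · ρ) (reduced-tail {u = lettersOutside Q I} f)
       | compare q Q ρ (reduced-descent {u = lettersOutside Q I} f)
  ... | σ′≈𝟙 | merged σ′≈σ _ _ _ = proj₁ (residue-𝟙-inside q Q ρ (trans (sym σ′≈σ) σ′≈𝟙))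
  ... | σ′≈𝟙 | parallel σ′≈qσ _ _ = proj₁ (residue-simple-outside q Q ρ (begin
    residue Q ρ             ≈⟨ simple-cancelˡ q _ ⟨
    q · q · residue Q ρ     ≈⟨ ∙-congˡ (trans (sym σ′≈qσ) σ′≈𝟙) ⟩
    q · 𝟙                   ≈⟨ identityʳ _ ⟩
    simple q                ∎))
    where open ≈-Reasoning

-- Equality of digraphs and shifted trees.

≐-sym : ∀ {A : Set} {ℓ} {G H : Digraph A ℓ} → G ≐ H → H ≐ G
≐-sym (v , e) = (λ x → ⇔.sym (v x)) , λ x y → ⇔.sym (e x y)

≐-trans : ∀ {A : Set} {ℓ} {G H K : Digraph A ℓ} → G ≐ H → H ≐ K → G ≐ K
≐-trans (v , e) (v′ , e′) = (λ x → ⇔.trans (v x) (v′ x)) , λ x y → ⇔.trans (e x y) (e′ x y)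

⊍-congˡ : ∀ {A : Set} {ℓ} (G : Digraph A ℓ) {H K} → H ≐ K → G ⊍ H ≐ G ⊍ K
⊍-congˡ G (v , e) = (λ x → ⇔.refl ⊎-⇔ v x) , λ x y → ⇔.refl ⊎-⇔ e x y

addEdge-cong : ∀ {A : Set} {ℓ} (a b : A) {G H : Digraph A ℓ} → G ≐ H → addEdge a b G ≐ addEdge a b H
addEdge-cong a b (v , e) = v , λ x y → e x y ⊎-⇔ ⇔.refl

-- Shifting and then adding position 1 amounts to prepending `inside`, which lets both subtrees be
-- handled as images under `b ∷_`.
⋆-^⇒ : ∀ {m ℓ} (T : Digraph (Subset m) ℓ) → zero ⋆ (T ^⇒) ≐ mapDigraph (inside ∷_) T
⋆-^⇒ T = (λ x → mk⇔ vertex⇒ vertex⇐) , λ x y → mk⇔ edge⇒ edge⇐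
  where
  ∪-zero : ∀ X → (outside ∷ X) ∪ ⁅ zero ⁆ ≡ inside ∷ X
  ∪-zero X = cong (inside ∷_) (∪-identityʳ X)

  vertex⇒ : ∀ {x} → Vertex (zero ⋆ (T ^⇒)) x → Vertex (mapDigraph (inside ∷_) T) x
  vertex⇒ (_ , (X , v , ≡.refl) , X≡) = X , v , ≡.trans (≡.sym (∪-zero X)) X≡

  vertex⇐ : ∀ {x} → Vertex (mapDigraph (inside ∷_) T) x → Vertex (zero ⋆ (T ^⇒)) x
  vertex⇐ (X , v , X≡) = outside ∷ X , (X , v , ≡.refl) , ≡.trans (∪-zero X) X≡

  edge⇒ : ∀ {x y} → Edge (zero ⋆ (T ^⇒)) x y → Edge (mapDigraph (inside ∷_) T) x y
  edge⇒ (_ , _ , (X , Y , e , ≡.refl , ≡.refl) , X≡ , Y≡) =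
    X , Y , e , ≡.trans (≡.sym (∪-zero X)) X≡ , ≡.trans (≡.sym (∪-zero Y)) Y≡

  edge⇐ : ∀ {x y} → Edge (mapDigraph (inside ∷_) T) x y → Edge (zero ⋆ (T ^⇒)) x y
  edge⇐ (X , Y , e , X≡ , Y≡) =
    outside ∷ X , outside ∷ Y , (X , Y , e , ≡.refl , ≡.refl) , ≡.trans (∪-zero X) X≡ , ≡.trans (∪-zero Y) Y≡

-- Increasing flips and rising paths relative to the first position.

module Flips {c ℓ} (C : CoxeterSystem c ℓ) where

  open CoxeterSystem C
  open SubwordComplex C hiding (S; W; _·_)
  open IncreasingFlip

  -- As `i < j`, position 1 is never the one inserted: label `zero` removes it, and any other label
  -- leaves it alone.
  zero-label : ∀ {m} {Q : Vec S (ℕ.suc m)} {ρ b b′ I J} (e : IncreasingFlip Q ρ (b ∷ I) (b′ ∷ J)) →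
               𝗉 Q ρ e ≡ zero → b ≡ inside × b′ ≡ outside
  zero-label record { i = zero ; j = suc _ ; i∈I = here ; ridge = r } ≡.refl =
    ≡.refl , ≡.sym (∷-injectiveˡ r)

  suc-label : ∀ {m} {Q : Vec S (ℕ.suc m)} {ρ b b′ I J k} (e : IncreasingFlip Q ρ (b ∷ I) (b′ ∷ J)) →
              𝗉 Q ρ e ≡ suc k → b ≡ b′
  suc-label record { i = suc _ ; j = suc _ ; ridge = r } ≡.refl = ∷-injectiveˡ r

  inside-label : ∀ {m} {Q : Vec S (ℕ.suc m)} {ρ I J} (e : IncreasingFlip Q ρ (inside ∷ I) (inside ∷ J)) →
                 zero {m} < 𝗉 Q ρ e
  inside-label e with 𝗉 _ _ e in eq
  ... | zero  = contradiction (proj₂ (zero-label e eq)) λ ()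
  ... | suc _ = ℕ.z<s

  flip-into-inside : ∀ {m} {Q : Vec S (ℕ.suc m)} {ρ b I J} → IncreasingFlip Q ρ (b ∷ I) (inside ∷ J) → b ≡ inside
  flip-into-inside e with 𝗉 _ _ e in eq
  ... | zero  = contradiction (proj₂ (zero-label e eq)) λ ()
  ... | suc _ = suc-label e eq

  flip-from-outside : ∀ {m} {Q : Vec S (ℕ.suc m)} {ρ b I J} → IncreasingFlip Q ρ (outside ∷ I) (b ∷ J) → b ≡ outside
  flip-from-outside e with 𝗉 _ _ e in eq
  ... | zero  = contradiction (proj₁ (zero-label e eq)) λ ()
  ... | suc _ = ≡.sym (suc-label e eq)

  AllPositive : ∀ {m} → List (Fin (ℕ.suc m)) → Set
  AllPositive {m} = All (zero {m} <_)

  -- Once position 1 is missing it never returns, so it cannot be removed later.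
  outside⇒positive : ∀ {m} {Q : Vec S (ℕ.suc m)} {ρ I K} (π : Path Q ρ (outside ∷ I) K) → AllPositive (labels Q ρ π)
  outside⇒positive ε = []
  outside⇒positive (_◅_ {j = b ∷ J} e π) with flip-from-outside e
  ... | ≡.refl with 𝗉 _ _ e in eq
  ...   | zero  = contradiction (proj₁ (zero-label e eq)) λ ()
  ...   | suc _ = ℕ.z<s ∷ outside⇒positive π

  -- Both subtrees are instances: `inside` with `σ` equal to `ρ`, and `outside` with `σ` equal to
  -- `q · ρ`.
  module Restriction {m} {q : S} {Q : Vec S m} {ρ σ : W} (b : Side)
                     (facet⇔ : ∀ I → IsFacet (q ∷ Q) ρ (b ∷ I) ⇔ IsFacet Q σ I) where

    lift-flip : ∀ {I J} → IncreasingFlip Q σ I J → IncreasingFlip (q ∷ Q) ρ (b ∷ I) (b ∷ J)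
    lift-flip e = record
      { facetˡ   = Equivalence.from (facet⇔ _) (facetˡ e)
      ; facetʳ   = Equivalence.from (facet⇔ _) (facetʳ e)
      ; distinct = distinct e ∘ ∷-injectiveʳ
      ; i        = suc (i e)
      ; j        = suc (j e)
      ; i∈I      = there (i∈I e)
      ; j∈J      = there (j∈J e)
      ; ridge    = cong (b ∷_) (ridge e)
      ; i<j      = ℕ.s<s (i<j e)
      }

    restrict-flip : ∀ {I J} (e : IncreasingFlip (q ∷ Q) ρ (b ∷ I) (b ∷ J)) →
                    ∃[ e′ ] (𝗉 (q ∷ Q) ρ e ≡ suc (𝗉 Q σ {I} {J} e′))
    restrict-flip record { i = zero ; j = suc _ ; i∈I = here ; ridge = () }
    restrict-flip record { facetˡ = f ; facetʳ = g ; distinct = I≢J ; i = suc i ; j = suc j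
                         ; i∈I = there i∈I ; j∈J = there j∈J ; ridge = r ; i<j = i<j } =
      record { facetˡ   = Equivalence.to (facet⇔ _) f
             ; facetʳ   = Equivalence.to (facet⇔ _) g
             ; distinct = I≢J ∘ cong (b ∷_)
             ; i        = i
             ; j        = j
             ; i∈I      = i∈I
             ; j∈J      = j∈J
             ; ridge    = ∷-injectiveʳ r
             ; i<j      = ℕ.s<s⁻¹ i<j
             } , ≡.refl

    prefix : Subset m × Subset m → Subset (ℕ.suc m) × Subset (ℕ.suc m)
    prefix (I , J) = b ∷ I , b ∷ J

    lift-path : ∀ {I J} → Path Q σ I J → Path (q ∷ Q) ρ (b ∷ I) (b ∷ J)
    lift-path ε       = ε
    lift-path (e ◅ π) = lift-flip e ◅ lift-path π

    labels-lift : ∀ {I J} (π : Path Q σ I J) → labels (q ∷ Q) ρ (lift-path π) ≡ map suc (labels Q σ π)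
    labels-lift ε       = ≡.refl
    labels-lift (e ◅ π) = cong (suc (i e) ∷_) (labels-lift π)

    edges-lift : ∀ {I J} (π : Path Q σ I J) → edges (q ∷ Q) ρ (lift-path π) ≡ map prefix (edges Q σ π)
    edges-lift ε       = ≡.refl
    edges-lift (e ◅ π) = cong (_ ∷_) (edges-lift π)

    lift-rising : ∀ {I J} (π : Path Q σ I J) → IsRising Q σ π → IsRising (q ∷ Q) ρ (lift-path π)
    lift-rising π rising = ≡.subst (Linked _<_) (≡.sym (labels-lift π)) (Linked.map⁺ (Linked.map ℕ.s<s rising))

    lift-∈edges : ∀ {I J X Y} (π : Path Q σ I J) → (X , Y) List.∈ edges Q σ π →
                  (b ∷ X , b ∷ Y) List.∈ edges (q ∷ Q) ρ (lift-path π)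
    lift-∈edges π XY∈ = ≡.subst (_ List.∈_) (≡.sym (edges-lift π)) (∈-map⁺ prefix XY∈)

    -- Being rising and traversing an edge depend only on the lists of labels and edges, so
    -- comparing these lists suffices.
    record Restricted {I K} (π : Path (q ∷ Q) ρ (b ∷ I) K) : Set ℓ where
      field
        {end}  : Subset m
        K≡     : K ≡ b ∷ end
        path   : Path Q σ I end
        labels≡ : labels (q ∷ Q) ρ π ≡ map suc (labels Q σ path)
        edges≡  : edges (q ∷ Q) ρ π ≡ map prefix (edges Q σ path)

      rising : IsRising (q ∷ Q) ρ π → IsRising Q σ path
      rising r = Linked.map ℕ.s<s⁻¹ (Linked.map⁻ (≡.subst (Linked _<_) labels≡ r))

      ∈edges : ∀ {x y} → (x , y) List.∈ edges (q ∷ Q) ρ π →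
               ∃[ X ] ∃[ Y ] ((X , Y) List.∈ edges Q σ path × b ∷ X ≡ x × b ∷ Y ≡ y)
      ∈edges xy∈ with ∈-map⁻ prefix (≡.subst (_ List.∈_) edges≡ xy∈)
      ... | (X , Y) , XY∈ , ≡.refl = X , Y , XY∈ , ≡.refl , ≡.refl

    restrict-path : ∀ {I K} (π : Path (q ∷ Q) ρ (b ∷ I) K) → AllPositive (labels (q ∷ Q) ρ π) → Restricted π
    restrict-path ε [] = record { K≡ = ≡.refl ; path = ε ; labels≡ = ≡.refl ; edges≡ = ≡.refl }
    restrict-path (_◅_ {j = b′ ∷ J} e π) (0<i ∷ 0<is) with 𝗉 _ _ e in eq
    ... | zero = contradiction 0<i λ ()
    ... | suc _ with suc-label e eq
    ...   | ≡.refl with restrict-flip e | restrict-path π 0<is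
    ...     | e′ , i≡ | record { K≡ = K≡ ; path = π′ ; labels≡ = ls ; edges≡ = es } = record
              { K≡      = K≡
              ; path    = e′ ◅ π′
              ; labels≡ = cong₂ _∷_ i≡ ls
              ; edges≡  = cong (_ ∷_) es
              }

    restrict-source : ∀ {I} → IsSource (q ∷ Q) ρ (b ∷ I) → IsSource Q σ I
    restrict-source (f , no-flip) = Equivalence.to (facet⇔ _) f , λ J e → no-flip (b ∷ J) (lift-flip e)

    -- A facet without position 1 may receive a flip from one containing it, so `same` has to
    -- exclude a change of head.
    lift-source : ∀ {I} → (∀ {b′ J} → IncreasingFlip (q ∷ Q) ρ (b′ ∷ J) (b ∷ I) → b′ ≡ b) →
                  IsSource Q σ I → IsSource (q ∷ Q) ρ (b ∷ I)
    lift-source {I} same (f , no-flip) = Equivalence.from (facet⇔ _) f , no-flip′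
      where
      no-flip′ : ∀ J → ¬ IncreasingFlip (q ∷ Q) ρ J (b ∷ I)
      no-flip′ (b′ ∷ J) e with same e
      ... | ≡.refl = no-flip J (proj₁ (restrict-flip e))

    ∈edges⇒edge : ∀ {P K x y} → IsPositiveGreedyFacet Q σ P → IsFacet (q ∷ Q) ρ K →
                  (π : Path (q ∷ Q) ρ (b ∷ P) K) → IsRising (q ∷ Q) ρ π → AllPositive (labels (q ∷ Q) ρ π) →
                  (x , y) List.∈ edges (q ∷ Q) ρ π → Edge (mapDigraph (b ∷_) (positiveSourceTree Q σ)) x y
    ∈edges⇒edge greedy f π rising positive xy∈ with restrict-path π positive
    ... | r@record { K≡ = ≡.refl } with Restricted.∈edges r xy∈
    ...   | X , Y , XY∈ , X≡ , Y≡ = X , Y , (_ , Restricted.end r , greedy , Equivalence.to (facet⇔ _) f ,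
      Restricted.path r , Restricted.rising r rising , XY∈) , X≡ , Y≡

    -- This is the situation of the first two cases of the theorem. No flip can then have label
    -- `zero`, since it would change the head.
    module _ (heads : ∀ b′ I → IsFacet (q ∷ Q) ρ (b′ ∷ I) → b′ ≡ b) where

      same-heads⇒positive : ∀ {I K} (π : Path (q ∷ Q) ρ I K) → AllPositive (labels (q ∷ Q) ρ π)
      same-heads⇒positive ε = []
      same-heads⇒positive (_◅_ {i = b₁ ∷ I₁} {j = b₂ ∷ I₂} e π) with 𝗉 _ _ e in eq
      ... | suc _ = ℕ.z<s ∷ same-heads⇒positive π
      ... | zero with zero-label e eq
      ...   | b₁≡in , b₂≡out = contradiction (begin
        inside  ≡⟨ b₁≡in ⟨
        b₁      ≡⟨ heads b₁ I₁ (facetˡ e) ⟩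
        b       ≡⟨ heads b₂ I₂ (facetʳ e) ⟨
        b₂      ≡⟨ b₂≡out ⟩
        outside ∎) λ ()
        where open ≡-Reasoning

      restrict-greedy : ∀ {P} → IsPositiveGreedyFacet (q ∷ Q) ρ (b ∷ P) → IsPositiveGreedyFacet Q σ P
      restrict-greedy (source , unique) = restrict-source source ,
        λ I source′ → ∷-injectiveʳ (unique (b ∷ I) (lift-source (heads _ _ ∘ facetˡ) source′))

      lift-greedy : ∀ {P} → IsPositiveGreedyFacet Q σ P → IsPositiveGreedyFacet (q ∷ Q) ρ (b ∷ P)
      lift-greedy {P} (source , unique) = lift-source (heads _ _ ∘ facetˡ) source , unique′
        where
        unique′ : ∀ I → IsSource (q ∷ Q) ρ I → I ≡ b ∷ P
        unique′ (b′ ∷ I) source′ with heads b′ I (proj₁ source′)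
        ... | ≡.refl = cong (b ∷_) (unique I (restrict-source source′))

      positiveSourceTree-≐ : positiveSourceTree (q ∷ Q) ρ ≐ mapDigraph (b ∷_) (positiveSourceTree Q σ)
      positiveSourceTree-≐ = (λ x → mk⇔ (vertex⇒ x) (vertex⇐ x)) , λ x y → mk⇔ edge⇒ edge⇐
        where
        vertex⇒ : ∀ x → IsFacet (q ∷ Q) ρ x → ∃[ X ] (IsFacet Q σ X × b ∷ X ≡ x)
        vertex⇒ (b′ ∷ X) f with heads b′ X f
        ... | ≡.refl = X , Equivalence.to (facet⇔ X) f , ≡.refl

        vertex⇐ : ∀ x → ∃[ X ] (IsFacet Q σ X × b ∷ X ≡ x) → IsFacet (q ∷ Q) ρ x
        vertex⇐ _ (X , f , ≡.refl) = Equivalence.from (facet⇔ X) f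

        edge⇒ : ∀ {x y} → Edge (positiveSourceTree (q ∷ Q) ρ) x y →
                Edge (mapDigraph (b ∷_) (positiveSourceTree Q σ)) x y
        edge⇒ (b′ ∷ P , K , greedy , f , π , rising , xy∈) with heads b′ P (proj₁ (proj₁ greedy))
        ... | ≡.refl = ∈edges⇒edge (restrict-greedy greedy) f π rising (same-heads⇒positive π) xy∈

        edge⇐ : ∀ {x y} → Edge (mapDigraph (b ∷_) (positiveSourceTree Q σ)) x y →
                Edge (positiveSourceTree (q ∷ Q) ρ) x y
        edge⇐ (X , Y , (P , K , greedy , f , π , rising , XY∈) , ≡.refl , ≡.refl) =
          b ∷ P , b ∷ K , lift-greedy greedy , Equivalence.from (facet⇔ K) f , lift-path π , lift-rising π rising , lift-∈edges π XY∈

-- Uniqueness of flips and of sources.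

module SourceTrees {c ℓ} (C : CoxeterSystem c ℓ)
                   (_≟_ : Decidable (Group._≈_ (CoxeterSystem.group C))) where

  open CoxeterSystem C
  open Group group hiding (_-_) renaming (ε to 𝟙)
  open Inversions C _≟_
  open Greedy C _≟_
  open SubwordComplex C hiding (S; W; _·_)
  open Flips C
  open IncreasingFlip

  ∣lettersOutside∣-≤ : ∀ {m} (Q : Vec S m) K j → length (lettersOutside Q K) ℕ.≤ length (lettersOutside Q (K - j))
  ∣lettersOutside∣-≤ (q ∷ Q) (inside ∷ K)  zero =
    ℕ.≤-trans (ℕ.≤-reflexive (cong (length ∘ lettersOutside Q) (≡.sym (p─⊥≡p K)))) (ℕ.n≤1+n _)
  ∣lettersOutside∣-≤ (q ∷ Q) (outside ∷ K) zero =
    s≤s (ℕ.≤-reflexive (cong (length ∘ lettersOutside Q) (≡.sym (p─⊥≡p K))))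
  ∣lettersOutside∣-≤ (q ∷ Q) (inside ∷ K)  (suc j) = ∣lettersOutside∣-≤ Q K j
  ∣lettersOutside∣-≤ (q ∷ Q) (outside ∷ K) (suc j) = s≤s (∣lettersOutside∣-≤ Q K j)

  -- If deleting the first letter or a later one had the same effect, deleting
  -- both would not change the element.
  deletions-differ : ∀ {m q} (Q : Vec S m) {w} K j → IsReducedExpression (q ∷ lettersOutside Q (K - j)) w →
                     ¬ (⟦ lettersOutside Q (K - j) ⟧ ≈ q · ⟦ lettersOutside Q K ⟧)
  deletions-differ {q = q} Q K j (⟦qu⟧ , min) u≈qv = contradiction (∣lettersOutside∣-≤ Q K j)
    (ℕ.<⇒≱ (min (lettersOutside Q K) (trans (sym (trans (∙-congˡ u≈qv) (simple-cancelˡ q _))) ⟦qu⟧)))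

  -- Deleting different letters of a reduced word yields different elements: common leading letters
  -- cancel until one of the deletions occurs, and there `deletions-differ` applies.
  deletion-injective : ∀ {m} (Q : Vec S m) {G w} K K′ {j j′} → j ∈ K → j′ ∈ K′ → K - j ≡ G → K′ - j′ ≡ G →
                       IsReducedExpression (lettersOutside Q G) w →
                       ⟦ lettersOutside Q K ⟧ ≈ ⟦ lettersOutside Q K′ ⟧ → K ≡ K′
  deletion-injective (q ∷ Q) (_ ∷ K) (_ ∷ K′) here here ≡.refl r _ _ =
    cong (inside ∷_) (≡.trans (≡.sym (p─⊥≡p K)) (≡.trans (≡.sym (∷-injectiveʳ r)) (p─⊥≡p K′)))
  deletion-injective (q ∷ Q) {w = w} (_ ∷ K) (_ ∷ K′) {j′ = suc j′} here (there _) ≡.refl r red eq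
    with ∷-injectiveˡ r | ≡.trans (∷-injectiveʳ r) (p─⊥≡p K)
  ... | ≡.refl | ≡.refl = contradiction eq (deletions-differ Q K′ j′
    (≡.subst (λ K → IsReducedExpression (q ∷ lettersOutside Q K) w) (p─⊥≡p (K′ - j′)) red))
  deletion-injective (q ∷ Q) (_ ∷ K) (_ ∷ K′) {j = suc j} (there _) here ≡.refl r red eq
    with ∷-injectiveˡ r | ≡.trans (≡.sym (∷-injectiveʳ r)) (p─⊥≡p K′)
  ... | ≡.refl | ≡.refl = contradiction (sym eq) (deletions-differ Q K j red)
  deletion-injective (q ∷ Q) (inside ∷ K) (b ∷ K′) (there j∈) (there j′∈) ≡.refl r red eq with ∷-injectiveˡ r
  ... | ≡.refl = cong (inside ∷_) (deletion-injective Q K K′ j∈ j′∈ ≡.refl (∷-injectiveʳ r) red eq)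
  deletion-injective (q ∷ Q) {w = w} (outside ∷ K) (b ∷ K′) {j = suc j} (there j∈) (there j′∈) ≡.refl r red eq with ∷-injectiveˡ r
  ... | ≡.refl = cong (outside ∷_) (deletion-injective Q K K′ j∈ j′∈ ≡.refl (∷-injectiveʳ r)
                   (reduced-tail {u = lettersOutside Q (K - j)} {w = w} red)
                   (trans (sym (simple-cancelˡ q _)) (trans (∙-congˡ eq) (simple-cancelˡ q _))))

  -- Both targets spell `q · ρ` by deleting one letter from the same reduced word for `ρ`, the one
  -- belonging to `I`.
  flip-target-unique : ∀ {m q} {Q : Vec S m} {ρ I J J′} → IncreasingFlip (q ∷ Q) ρ (inside ∷ I) (outside ∷ J) →
                       IncreasingFlip (q ∷ Q) ρ (inside ∷ I) (outside ∷ J′) → J ≡ J′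
  flip-target-unique {q = q} {Q = Q} {I = I} {J} {J′}
    record { facetˡ = f ; facetʳ = g ; i = zero ; j = suc _ ; j∈J = there j∈ ; ridge = r }
    record { facetʳ = g′ ; i = zero ; j = suc _ ; j∈J = there j′∈ ; ridge = r′ } =
    deletion-injective Q J J′ j∈ j′∈ (≡.trans (≡.sym (∷-injectiveʳ r)) (p─⊥≡p I))
      (≡.trans (≡.sym (∷-injectiveʳ r′)) (p─⊥≡p I)) f
      (trans (proj₁ (reduced-tail {u = lettersOutside Q J} g)) (sym (proj₁ (reduced-tail {u = lettersOutside Q J′} g′))))
  flip-target-unique record { i = suc _ ; j = suc _ ; ridge = () } _
  flip-target-unique record { i = zero ; j = suc _ } record { i = suc _ ; j = suc _ ; ridge = () }

  module _ {m} (q : S) (Q : Vec S m) (ρ : W) where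

    facet-inside : ∀ I → IsFacet (q ∷ Q) ρ (inside ∷ I) ⇔ IsFacet Q ρ I
    facet-inside I = mk⇔ (λ f → f) (λ f → f)

    -- This is the additional edge of the third case. The runs have merged because `𝟙` has no
    -- descents, and the position where they merged is the one inserted by the flip.
    greedy-flip : residue Q ρ ≈ 𝟙 → N ρ (simple q) ≡ true → residue Q (q · ρ) ≈ 𝟙 ×
                  ∃[ e ] (𝗉 (q ∷ Q) ρ {inside ∷ greedy Q ρ} {outside ∷ greedy Q (q · ρ)} e ≡ zero)
    greedy-flip σ≈𝟙 desc with compare q Q ρ desc
    ... | parallel _ _ descσ = contradiction (≡.trans (≡.sym descσ) (N-𝟙 σ≈𝟙 (simple q))) λ ()
    ... | merged σ′≈σ j j∈ r = trans σ′≈σ σ≈𝟙 , record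
      { facetˡ   = greedy-facet Q ρ σ≈𝟙
      ; facetʳ   = Equivalence.from (facet-outside {Q = Q} {ρ} desc) (greedy-facet Q (q · ρ) (trans σ′≈σ σ≈𝟙))
      ; distinct = λ ()
      ; i        = zero
      ; j        = suc j
      ; i∈I      = here
      ; j∈J      = there j∈
      ; ridge    = cong (outside ∷_) (≡.trans (p─⊥≡p _) (≡.sym r))
      ; i<j      = ℕ.z<s
      } , ≡.refl

    outside-descent : ∀ {I} → IsFacet (q ∷ Q) ρ (outside ∷ I) → N ρ (simple q) ≡ true
    outside-descent {I} = reduced-descent {u = lettersOutside Q I}

  -- Induction on `Q`, split by whether some facet contains position 1, which is decided by
  -- `residue Q ρ`.
  greedy-isPositiveGreedyFacet : ∀ {m} (Q : Vec S m) ρ → residue Q ρ ≈ 𝟙 → IsPositiveGreedyFacet Q ρ (greedy Q ρ)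
  greedy-isPositiveGreedyFacet [] ρ 𝟙≈ρ = (greedy-facet [] ρ 𝟙≈ρ , λ _ e → Fin.¬Fin0 (i e)) , λ where [] _ → ≡.refl
  greedy-isPositiveGreedyFacet (q ∷ Q) ρ σ≈𝟙 with residue Q ρ ≟ 𝟙
  ... | yes τ≈𝟙 = ≡.subst (IsPositiveGreedyFacet (q ∷ Q) ρ) (≡.sym (proj₂ (residue-𝟙-inside q Q ρ τ≈𝟙)))
                  (lift-source flip-into-inside (proj₁ ih) , unique)
    where
    open Restriction {q = q} {Q} {ρ} inside (facet-inside q Q ρ)
    ih = greedy-isPositiveGreedyFacet Q ρ τ≈𝟙
    unique : ∀ I → IsSource (q ∷ Q) ρ I → I ≡ inside ∷ greedy Q ρ
    unique (inside ∷ I)  source = cong (inside ∷_) (proj₂ ih I (restrict-source source))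
    -- By induction `I` would be the greedy facet for `q · ρ`, but `greedy-flip` leads into it.
    unique (outside ∷ I) source with greedy-flip q Q ρ τ≈𝟙 (outside-descent q Q ρ {I} (proj₁ source))
    ... | τ′≈𝟙 , e , _ with proj₂ (greedy-isPositiveGreedyFacet Q (q · ρ) τ′≈𝟙) I
                        (Restriction.restrict-source outside (λ _ → facet-outside {Q = Q} {ρ} (outside-descent q Q ρ {I} (proj₁ source))) source)
    ...   | ≡.refl = contradiction e (proj₂ source _)
  -- The residue reaches `𝟙` only at the last letter read, so `q` is used, and no facet contains
  -- position 1.
  ... | no τ≉𝟙 with R (residue Q ρ) (simple q) | σ≈𝟙 | greedy-facet (q ∷ Q) ρ σ≈𝟙
  ...   | false | τ≈𝟙 | _ = contradiction τ≈𝟙 τ≉𝟙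
  ...   | true  | _   | f with outside-descent q Q ρ {greedy Q ρ} f
                       | facet⇒residue Q (q · ρ) (reduced-tail {u = greedyWord Q ρ} f)
  ...     | desc | τ′≈𝟙 with compare q Q ρ desc
  ...       | merged τ′≈τ _ _ _ = contradiction (trans (sym τ′≈τ) τ′≈𝟙) τ≉𝟙
  -- The greedy facets of `Q` for `ρ` and `q · ρ` coincide, so the induction hypothesis for `q · ρ`
  -- applies.
  ...       | parallel _ same _ = ≡.subst (λ P → IsPositiveGreedyFacet (q ∷ Q) ρ (outside ∷ P)) same
              (lift-greedy all-outside (greedy-isPositiveGreedyFacet Q (q · ρ) τ′≈𝟙))
    where
    open Restriction {q = q} {Q} {ρ} {q · ρ} outside (λ _ → facet-outside {Q = Q} {ρ} desc)
    all-outside : ∀ b I → IsFacet (q ∷ Q) ρ (b ∷ I) → b ≡ outside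
    all-outside inside  I f = contradiction (facet⇒residue Q ρ f) τ≉𝟙
    all-outside outside I f = ≡.refl

  -- The source tree in each of the three cases.

  module _ {m} (q : S) (Q : Vec S m) (ρ : W) where

    T₀ T₁ : Digraph (Subset (ℕ.suc m)) ℓ
    T₀ = positiveSourceTree Q (q · ρ) ^⇒
    T₁ = mapDigraph (inside ∷_) (positiveSourceTree Q ρ)

    sourceTree-outside : (∀ I → IsFacet (q ∷ Q) ρ I → zero ∉ I) → positiveSourceTree (q ∷ Q) ρ ≐ T₀
    sourceTree-outside in-none = positiveSourceTree-≐ all-outside
      where
      facet⇒ : ∀ I → IsFacet Q (q · ρ) I → IsFacet (q ∷ Q) ρ (outside ∷ I)
      facet⇒ I f with N ρ (simple q) in eq
      ... | true  = Equivalence.from (facet-outside {Q = Q} {ρ} eq) f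
      -- If `q` is no left descent of `ρ`, it is one of `q · ρ`. Then `greedy-flip` for `q · ρ`
      -- shows that `Q` already contains a reduced word for `ρ`, giving a facet with position 1.
      ... | false = contradiction here (in-none (inside ∷ greedy Q (q · q · ρ))
        (IsReducedExpression-cong {u = greedyWord Q (q · q · ρ)} (simple-cancelˡ q ρ) (greedy-facet Q (q · q · ρ) σ≈𝟙)))
        where
        σ≈𝟙 : residue Q (q · q · ρ) ≈ 𝟙
        σ≈𝟙 = proj₁ (greedy-flip q Q (q · ρ) (facet⇒residue Q (q · ρ) f) (≡.trans (N-· q ρ) (cong not eq)))
      open Restriction {q = q} {Q} {ρ} {q · ρ} outside
        (λ I → mk⇔ (reduced-tail {u = lettersOutside Q I}) (facet⇒ I))
      all-outside : ∀ b I → IsFacet (q ∷ Q) ρ (b ∷ I) → b ≡ outside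
      all-outside inside  I f = contradiction here (in-none (inside ∷ I) f)
      all-outside outside I f = ≡.refl

    sourceTree-inside : (∀ I → IsFacet (q ∷ Q) ρ I → zero ∈ I) → positiveSourceTree (q ∷ Q) ρ ≐ T₁
    sourceTree-inside in-all = Restriction.positiveSourceTree-≐ inside (facet-inside q Q ρ) all-inside
      where
      all-inside : ∀ b I → IsFacet (q ∷ Q) ρ (b ∷ I) → b ≡ inside
      all-inside b I f with in-all (b ∷ I) f
      ... | here = ≡.refl

    -- The third case: `τ≈𝟙` yields a facet containing position 1, and together with `desc` it
    -- yields one avoiding it.
    module _ (τ≈𝟙 : residue Q ρ ≈ 𝟙) (desc : N ρ (simple q) ≡ true) where

      private
        P₀ P₁ : Subset m
        P₀ = greedy Q (q · ρ)
        P₁ = greedy Q ρ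

        facet-outside′ : ∀ I → IsFacet (q ∷ Q) ρ (outside ∷ I) ⇔ IsFacet Q (q · ρ) I
        facet-outside′ I = facet-outside {Q = Q} {ρ} {I} desc

        module In  = Restriction {q = q} {Q} {ρ} {ρ} inside (facet-inside q Q ρ)
        module Out = Restriction {q = q} {Q} {ρ} {q · ρ} outside facet-outside′

        root-flip : IncreasingFlip (q ∷ Q) ρ (inside ∷ P₁) (outside ∷ P₀)
        root-flip = proj₁ (proj₂ (greedy-flip q Q ρ τ≈𝟙 desc))

        root-label : 𝗉 (q ∷ Q) ρ root-flip ≡ zero
        root-label = proj₂ (proj₂ (greedy-flip q Q ρ τ≈𝟙 desc))

      outside-isPositiveGreedyFacet : IsPositiveGreedyFacet Q (q · ρ) P₀
      outside-isPositiveGreedyFacet =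
        greedy-isPositiveGreedyFacet Q (q · ρ) (proj₁ (greedy-flip q Q ρ τ≈𝟙 desc))

      inside-isPositiveGreedyFacet : IsPositiveGreedyFacet Q ρ P₁
      inside-isPositiveGreedyFacet = greedy-isPositiveGreedyFacet Q ρ τ≈𝟙

      root-isPositiveGreedyFacet : IsPositiveGreedyFacet (q ∷ Q) ρ (inside ∷ P₁)
      root-isPositiveGreedyFacet with residue-𝟙-inside q Q ρ τ≈𝟙
      ... | σ≈𝟙 , root≡ = ≡.subst (IsPositiveGreedyFacet (q ∷ Q) ρ) root≡ (greedy-isPositiveGreedyFacet (q ∷ Q) ρ σ≈𝟙)

      sourceTree-both : positiveSourceTree (q ∷ Q) ρ ≐ addEdge (inside ∷ P₁) (outside ∷ P₀) (T₀ ⊍ T₁)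
      sourceTree-both = (λ x → mk⇔ (vertex⇒ x) vertex⇐) , λ x y → mk⇔ edge⇒ edge⇐
        where
        vertex⇒ : ∀ x → IsFacet (q ∷ Q) ρ x → Vertex (T₀ ⊍ T₁) x
        vertex⇒ (inside ∷ X)  f = inj₂ (X , f , ≡.refl)
        vertex⇒ (outside ∷ X) f = inj₁ (X , Equivalence.to (facet-outside′ X) f , ≡.refl)

        vertex⇐ : ∀ {x} → Vertex (T₀ ⊍ T₁) x → IsFacet (q ∷ Q) ρ x
        vertex⇐ (inj₁ (X , f , ≡.refl)) = Equivalence.from (facet-outside′ X) f
        vertex⇐ (inj₂ (X , f , ≡.refl)) = f

        root-path : ∀ {K x y} → IsFacet (q ∷ Q) ρ K → (π : Path (q ∷ Q) ρ (inside ∷ P₁) K) → IsRising (q ∷ Q) ρ π →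
                    (x , y) List.∈ edges (q ∷ Q) ρ π →
                    Edge (addEdge (inside ∷ P₁) (outside ∷ P₀) (T₀ ⊍ T₁)) x y
        -- The first label is positive, hence so are all labels of the rising path, and position 1
        -- is kept throughout.
        root-path f π@(_◅_ {j = inside ∷ J} e _) rising xy∈ = inj₁ (inj₂
          (In.∈edges⇒edge inside-isPositiveGreedyFacet f π rising
            (Linked.Linked⇒All Fin.<-trans (inside-label e) rising) xy∈))
        -- A first step that drops position 1 can only be the additional edge.
        root-path f (_◅_ {j = outside ∷ J} e π) rising xy∈ with flip-target-unique e root-flip
        root-path f (e ◅ π) rising (here ≡.refl) | ≡.refl = inj₂ (≡.refl , ≡.refl)
        root-path f (e ◅ π) rising (there xy∈)   | ≡.refl = inj₁ (inj₁
          (Out.∈edges⇒edge outside-isPositiveGreedyFacet f π (Linked.tail rising) (outside⇒positive π) xy∈))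

        edge⇒ : ∀ {x y} → Edge (positiveSourceTree (q ∷ Q) ρ) x y →
                Edge (addEdge (inside ∷ P₁) (outside ∷ P₀) (T₀ ⊍ T₁)) x y
        edge⇒ (P , K , greedy , f , π , rising , xy∈) with proj₂ root-isPositiveGreedyFacet P (proj₁ greedy)
        ... | ≡.refl = root-path f π rising xy∈

        root-rising : ∀ {K} (π : Path Q (q · ρ) P₀ K) → IsRising Q (q · ρ) π →
                      IsRising (q ∷ Q) ρ (root-flip ◅ Out.lift-path π)
        root-rising ε [] = [-]
        root-rising (e ◅ π) rising = ≡.subst (_< suc (i e)) (≡.sym root-label) ℕ.z<s ∷ Out.lift-rising (e ◅ π) rising

        edge⇐ : ∀ {x y} → Edge (addEdge (inside ∷ P₁) (outside ∷ P₀) (T₀ ⊍ T₁)) x y →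
                Edge (positiveSourceTree (q ∷ Q) ρ) x y
        edge⇐ (inj₂ (≡.refl , ≡.refl)) =
          inside ∷ P₁ , outside ∷ P₀ , root-isPositiveGreedyFacet , facetʳ root-flip , root-flip ◅ ε , [-] , here ≡.refl
        -- Uniqueness of the source makes the path start at `P₀`; its lift is then preceded by
        -- `root-flip`, whose label lies below all shifted ones.
        edge⇐ (inj₁ (inj₁ (X , Y , (P , K , greedy , f , π , rising , XY∈) , ≡.refl , ≡.refl)))
          with proj₂ outside-isPositiveGreedyFacet P (proj₁ greedy)
        ... | ≡.refl = inside ∷ P₁ , outside ∷ K , root-isPositiveGreedyFacet , Equivalence.from (facet-outside′ K) f ,
              root-flip ◅ Out.lift-path π , root-rising π rising , there (Out.lift-∈edges π XY∈)
        edge⇐ (inj₁ (inj₂ (X , Y , (P , K , greedy , f , π , rising , XY∈) , ≡.refl , ≡.refl)))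
          with proj₂ inside-isPositiveGreedyFacet P (proj₁ greedy)
        ... | ≡.refl = inside ∷ P₁ , inside ∷ K , root-isPositiveGreedyFacet , f ,
              In.lift-path π , In.lift-rising π rising , In.lift-∈edges π XY∈

proposition4p18 :
    ∀ {c ℓ} (C : CoxeterSystem c ℓ) → IsFinite C →
    let open SubwordComplex C in
    ∀ {m : ℕ} (q₁ : S) (Q⊢ : Vec S m) (ρ : W) →
    let Q = q₁ ∷ Q⊢
        T₀ = positiveSourceTree Q⊢ (q₁ · ρ) ^⇒
        T₁ = zero ⋆ (positiveSourceTree Q⊢ ρ ^⇒)
        in-none = ∀ I → IsFacet Q ρ I → zero ∉ I
        in-all = ∀ I → IsFacet Q ρ I → zero ∈ I
    in
      (in-none → positiveSourceTree Q ρ ≐ T₀)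
    × (in-all → positiveSourceTree Q ρ ≐ T₁)
    × (¬ in-none → ¬ in-all →
        Disjoint T₀ T₁
        × (∃[ P ] ∃[ P₀ ] ∃[ P₁ ]
            (IsPositiveGreedyFacet Q ρ P
            × IsPositiveGreedyFacet Q⊢ (q₁ · ρ) P₀
            × IsPositiveGreedyFacet Q⊢ ρ P₁
            × P ≡ ⁅ zero ⁆ ∪ P₁ ^→
            × positiveSourceTree Q ρ ≐ addEdge P (P₀ ^→) (T₀ ⊍ T₁))))
proposition4p18 C (_ , W↔Fin) q₁ Q⊢ ρ =
    sourceTree-outside q₁ Q⊢ ρ
  , (λ in-all → ≐-trans (sourceTree-inside q₁ Q⊢ ρ in-all) T₁≐)
  , λ ¬in-none ¬in-all → disjoint , both ¬in-none ¬in-all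
  where
  open CoxeterSystem C
  open Group group using (_≈_) renaming (ε to 𝟙; sym to ≈-sym; trans to ≈-trans)
  open SubwordComplex C hiding (S; W; _·_)

  -- Elements are compared through the enumeration of the finite group.
  _≟_ : Decidable _≈_
  _≟_ = Fin.inj⇒≟ (Inverse⇒Injection W↔Fin)

  open Inversions C _≟_ using (N)
  open Greedy C _≟_
  open SourceTrees C _≟_

  T₁′ : Digraph (Subset _) _
  T₁′ = zero ⋆ (positiveSourceTree Q⊢ ρ ^⇒)

  T₁≐ : T₁ q₁ Q⊢ ρ ≐ T₁′
  T₁≐ = ≐-sym (⋆-^⇒ (positiveSourceTree Q⊢ ρ))

  disjoint : Disjoint (T₀ q₁ Q⊢ ρ) T₁′
  disjoint _ ((_ , _ , ≡.refl) , (_ , (_ , _ , ≡.refl) , ()))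

  both : ¬ (∀ I → IsFacet (q₁ ∷ Q⊢) ρ I → zero ∉ I) → ¬ (∀ I → IsFacet (q₁ ∷ Q⊢) ρ I → zero ∈ I) →
         ∃[ P ] ∃[ P₀ ] ∃[ P₁ ]
           (IsPositiveGreedyFacet (q₁ ∷ Q⊢) ρ P
           × IsPositiveGreedyFacet Q⊢ (q₁ · ρ) P₀
           × IsPositiveGreedyFacet Q⊢ ρ P₁
           × P ≡ ⁅ zero ⁆ ∪ P₁ ^→
           × positiveSourceTree (q₁ ∷ Q⊢) ρ ≐ addEdge P (P₀ ^→) (T₀ q₁ Q⊢ ρ ⊍ T₁′))
  both ¬in-none ¬in-all with residue Q⊢ ρ ≟ 𝟙 | N ρ (simple q₁) in eq
  -- A facet containing position 1 would bring the residue to `𝟙`, so there is none.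
  ... | no τ≉𝟙  | _     = contradiction (λ where (_ ∷ _) f here → τ≉𝟙 (facet⇒residue Q⊢ ρ f)) ¬in-none
  -- A facet avoiding position 1 would make `q₁` a left descent of `ρ`, so all facets contain it.
  ... | yes _   | false = contradiction (λ where
        (inside ∷ I)  f → here
        (outside ∷ I) f → contradiction (≡.trans (≡.sym eq) (outside-descent q₁ Q⊢ ρ {I} f)) λ ()) ¬in-all
  ... | yes τ≈𝟙 | true  =
        inside ∷ greedy Q⊢ ρ , greedy Q⊢ (q₁ · ρ) , greedy Q⊢ ρ
      , root-isPositiveGreedyFacet q₁ Q⊢ ρ τ≈𝟙 eq
      , outside-isPositiveGreedyFacet q₁ Q⊢ ρ τ≈𝟙 eq
      , inside-isPositiveGreedyFacet q₁ Q⊢ ρ τ≈𝟙 eq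
      , cong (inside ∷_) (≡.sym (∪-identityˡ (greedy Q⊢ ρ)))
      , ≐-trans (sourceTree-both q₁ Q⊢ ρ τ≈𝟙 eq) (addEdge-cong _ _ (⊍-congˡ _ T₁≐))
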